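{- Let $G=(V,E)$ be a finite simple undirected graph and $\gamma\in(0,1)$. If for every initial state $s_0\in S$ there exists a Nash equilibrium $\widehat{\sigma}$ of $\Gamma_3(G|s_0)$ (in deterministic strategies) with $\mathbf{K}_3(G|s_0,\widehat{\sigma})>0$, then $c(G)=1$.
   Context: Game $\Gamma_3(G|s_0)$. $N[x]$ is the closed neighborhood of $x$ in $G$. Nonterminal states: $S=\{(x^1,x^2,x^3,p): x^i\in V,\ p\in\{1,2,3\}\}$, where $x^i$ is the vertex of player $P_i$ and $p$ is the index of the player who moves next. There is one additional terminal state $\overline{s}$. Capture sets: $\widetilde{S}^1=\{s\in S: x^1=x^2\}$ ($P_1$ captures $P_2$), $\widetilde{S}^2=\{s\in S: x^2=x^3\}$ ($P_2$ captures $P_3$); $S_C=\widetilde{S}^1\cup\widetilde{S}^2$, $S_{NC}=S\setminus S_C$. Action sets: for $s=(x^1,x^2,x^3,p)\in S_{NC}$, $A^p(s)=N[x^p]$ and $A^m(s)=\{x^m\}$ for $m\neq p$; for $s\in S_C\cup\{\overline{s}\}$, $A^m(s)=\{\lambda\}$ (null move). Transitions: for $s=(x^1,x^2,x^3,n)\in S_{NC}$ and $a\in A^n(s)$, $\mathbf{T}(s,a)$ is obtained by replacing $x^n$ by $a$ and letting the next mover be $n+1$ (or $1$ if $n=3$). For $s\in S_C\cup\{\overline{s}\}$, $\mathbf{T}(s,\lambda)=\overline{s}$. Strategies: a deterministic strategy $\sigma^n$ assigns to each finite history $s_0s_1\dots s_t$ ($t\ge0$) an action in $A^n(s_t)$.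 A profile $\sigma$ and a starting state $s_0$ determine a play $s_0s_1s_2\dots$ with $s_{t+1}=\mathbf{T}(s_t,a)$, $a$ being the action chosen by the player who has the move (and $a=\lambda$ when $s_t\in S_C\cup\{\overline{s}\}$). $\sigma^{ -n}$ denotes the strategies of the players other than $P_n$. Turn payoffs: $q^1(s)=1$ if $s\in\widetilde{S}^1$, else $0$; $q^2(s)=-1$ if $s\in\widetilde{S}^1$, $1$ if $s\in\widetilde{S}^2\setminus\widetilde{S}^1$, else $0$; $q^3(s)=-1$ if $s\in\widetilde{S}^2\setminus\widetilde{S}^1$, else $0$. Total payoffs: $Q^n(s_0,\sigma)=\sum_{t=0}^\infty\gamma^tq^n(s_t)$. A Nash equilibrium of $\Gamma_3(G|s_0)$ is a profile $\widehat\sigma$ with $Q^n(s_0,\widehat\sigma)\ge Q^n(s_0,\sigma^n,\widehat\sigma^{ -n})$ for all $n\in\{1,2,3\}$ and all $\sigma^n$. Capture function: $\mathbf{K}_3(G|s_0,\sigma)=0$ when $Q^1(s_0,\sigma)=Q^2(s_0,\sigma)=Q^3(s_0,\sigma)=0$; $=1$ when $Q^1(s_0,\sigma)>0$; $=2$ when $Q^2(s_0,\sigma)>0$. Cop number: in the classic Cops and Robbers game on $G$, the cop player first places $k$ cop tokens on vertices, then the robber player, seeing this, places the robber; afterwards they alternate, the cop player moving each cop token to a vertex in the closed neighborhood of its position, then the robber player likewise moving the robber. Cops win if at some time a cop token and the robber are on the same vertex. $c(G)$ is the smallest $k$ for which the cop player can guarantee capture; $G$ is cop-win iff $c(G)=1$.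 -}

module Defs where

open import Algebra.Apartness.Bundles using (HeytingField)
open import Algebra.Apartness.Structures using (IsHeytingField)
open import Algebra.Bundles using (CommutativeRing)
open import Algebra.Core using (Op₁; Op₂)
import Algebra.Definitions.RawMonoid as RawMonoidDefs
import Algebra.Properties.Ring as RingProperties
import Algebra.Properties.Semiring.Exp as SemiringExp
import Algebra.Properties.Semiring.Mult as SemiringMult
import Algebra.Solver.Ring.NaturalCoefficients.Default as SemiringSolver
open import Data.Bool.Base using (true; false; if_then_else_)
open import Data.Empty using (⊥-elim)
open import Data.Fin.Base using (Fin; zero; suc)
import Data.Fin.Properties as Fin
open import Data.List.Base using (List; []; _∷ʳ_)
open import Data.Nat.Base as ℕ using (ℕ; zero; suc)
import Data.Nat.Properties as ℕ
open import Data.Product.Base using (∃-syntax; _×_; _,_; proj₁; proj₂)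
open import Data.Sum.Base using (_⊎_; inj₁; inj₂)
open import Data.Vec.Base using (Vec; lookup; _[_]≔_)
open import Data.Vec.Membership.Propositional using () renaming (_∈_ to _∈ᵛ_)
open import Function.Base using (_∘_)
open import Level using (_⊔_; 0ℓ) renaming (suc to lsuc)
open import Relation.Binary.Core using (Rel)
open import Relation.Binary.Definitions using (Symmetric; Irreflexive; Decidable)
open import Relation.Binary.PropositionalEquality using (_≡_; _≢_; refl)
import Relation.Binary.PropositionalEquality as ≡
import Relation.Binary.Reasoning.Base.Triple as TripleReasoning
open import Relation.Binary.Structures using (IsStrictPartialOrder; IsPreorder)
open import Relation.Nullary.Decidable.Core using (Dec; yes; no; does)
open import Relation.Nullary.Negation.Core using (¬_)

-- The real numbers, axiomatised as an Archimedean, Cauchy-complete ordered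
-- field.  Classically these axioms determine ℝ up to isomorphism;
-- constructively they are the usual ones, with apartness x < y or y < x.

record RealNumbers c ℓ₁ ℓ₂ : Set (lsuc (c ⊔ ℓ₁ ⊔ ℓ₂)) where
  infix  8 -_
  infixl 7 _*_
  infixl 6 _+_
  infix  4 _≈_ _<_ _>_ _≤_ _≥_ _#_ _⟶_
  field
    Carrier : Set c
    _≈_     : Rel Carrier ℓ₁
    _<_     : Rel Carrier ℓ₂
    _+_ _*_ : Op₂ Carrier
    -_      : Op₁ Carrier
    0# 1#   : Carrier

  _#_ : Rel Carrier ℓ₂
  x # y = x < y ⊎ y < x

  _>_ : Rel Carrier ℓ₂
  x > y = y < x

  _≤_ : Rel Carrier ℓ₂
  x ≤ y = ¬ (y < x)

  _≥_ : Rel Carrier ℓ₂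
  x ≥ y = y ≤ x

  field
    isHeytingField       : IsHeytingField _≈_ _#_ _+_ _*_ -_ 0# 1#
    isStrictPartialOrder : IsStrictPartialOrder _≈_ _<_
    +-monoʳ-<            : ∀ z {x y} → x < y → z + x < z + y
    *-pos                : ∀ {x y} → 0# < x → 0# < y → 0# < x * y

  heytingField : HeytingField c ℓ₁ ℓ₂
  heytingField = record { isHeytingField = isHeytingField }

  open IsHeytingField isHeytingField public
    using (isCommutativeRing; #⇒invertible; invertible⇒#; #-cotrans; tight)

  commutativeRing : CommutativeRing c ℓ₁
  commutativeRing = record { isCommutativeRing = isCommutativeRing }

  open CommutativeRing commutativeRing using (+-rawMonoid)

  private
    infixr 8 _·_

    _·_ : ℕ → Carrier → Carrier
    _·_ = RawMonoidDefs._×_ +-rawMonoid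

  -- ∣x - y∣ < ε
  Within : Carrier → Carrier → Carrier → Set ℓ₂
  Within ε x y = (x < y + ε) × (y < x + ε)

  Cauchy : (ℕ → Carrier) → Set (c ⊔ ℓ₂)
  Cauchy s = ∀ ε → 0# < ε →
    ∃[ N ] ∀ m n → N ℕ.≤ m → N ℕ.≤ n → Within ε (s m) (s n)

  _⟶_ : (ℕ → Carrier) → Carrier → Set (c ⊔ ℓ₂)
  s ⟶ l = ∀ ε → 0# < ε → ∃[ N ] ∀ n → N ℕ.≤ n → Within ε (s n) l

  field
    archimedean : ∀ {x} y → 0# < x → ∃[ n ] y < n · x
    complete    : ∀ s → Cauchy s → ∃[ l ] s ⟶ l

module OrderProperties {c ℓ₁ ℓ₂} (ℝ : RealNumbers c ℓ₁ ℓ₂) where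

  open RealNumbers ℝ
  open CommutativeRing commutativeRing public
    hiding (Carrier; _≈_; _+_; _*_; -_; 0#; 1#; refl; sym; trans)
  open CommutativeRing commutativeRing public
    using () renaming (refl to ≈-refl; sym to ≈-sym; trans to ≈-trans)
  open RingProperties ring public using (-0#≈0#; -‿involutive; -‿+-comm; -‿distribʳ-*)
  open IsStrictPartialOrder isStrictPartialOrder public
    using (<-resp-≈)
    renaming (irrefl to <-irrefl; trans to <-trans; asym to <-asym)

  <-cotrans : ∀ {x y} → x < y → ∀ z → x < z ⊎ z < y
  <-cotrans x<y z with #-cotrans (inj₁ x<y) z
  ... | inj₁ (inj₁ x<z) = inj₁ x<z
  ... | inj₁ (inj₂ z<x) = inj₂ (<-trans z<x x<y)
  ... | inj₂ (inj₁ z<y) = inj₂ z<y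
  ... | inj₂ (inj₂ y<z) = inj₁ (<-trans x<y y<z)

  <⇒≤ : ∀ {x y} → x < y → x ≤ y
  <⇒≤ = <-asym

  ≤-reflexive : ∀ {x y} → x ≈ y → x ≤ y
  ≤-reflexive x≈y = <-irrefl (≈-sym x≈y)

  ≤-trans : ∀ {x y z} → x ≤ y → y ≤ z → x ≤ z
  ≤-trans {y = y} x≤y y≤z z<x with <-cotrans z<x y
  ... | inj₁ z<y = y≤z z<y
  ... | inj₂ y<x = x≤y y<x

  <-≤-trans : ∀ {x y z} → x < y → y ≤ z → x < z
  <-≤-trans {z = z} x<y y≤z with <-cotrans x<y z
  ... | inj₁ x<z = x<z
  ... | inj₂ z<y = ⊥-elim (y≤z z<y)

  ≤-<-trans : ∀ {x y z} → x ≤ y → y < z → x < z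
  ≤-<-trans {x} x≤y y<z with <-cotrans y<z x
  ... | inj₁ y<x = ⊥-elim (x≤y y<x)
  ... | inj₂ x<z = x<z

  ≤-isPreorder : IsPreorder _≈_ _≤_
  ≤-isPreorder = record
    { isEquivalence = isEquivalence
    ; reflexive     = ≤-reflexive
    ; trans         = ≤-trans
    }

  module ≤-Reasoning =
    TripleReasoning ≤-isPreorder <-asym <-trans <-resp-≈ <⇒≤ <-≤-trans ≤-<-trans

  private
    -x+[x+y]≈y : ∀ x y → - x + (x + y) ≈ y
    -x+[x+y]≈y x y = ≈-trans (≈-sym (+-assoc (- x) x y))
      (≈-trans (+-congʳ (-‿inverseˡ x)) (+-identityˡ y))

  +-cancelˡ-< : ∀ z {x y} → z + x < z + y → x < y
  +-cancelˡ-< z {x} {y} p = begin-strict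
    x              ≈⟨ -x+[x+y]≈y z x ⟨
    - z + (z + x)  <⟨ +-monoʳ-< (- z) p ⟩
    - z + (z + y)  ≈⟨ -x+[x+y]≈y z y ⟩
    y              ∎
    where open ≤-Reasoning

  +-monoʳ-≤ : ∀ z {x y} → x ≤ y → z + x ≤ z + y
  +-monoʳ-≤ z x≤y p = x≤y (+-cancelˡ-< z p)

  +-monoˡ-≤ : ∀ z {x y} → x ≤ y → x + z ≤ y + z
  +-monoˡ-≤ z {x} {y} x≤y = begin
    x + z ≈⟨ +-comm x z ⟩
    z + x ≤⟨ +-monoʳ-≤ z x≤y ⟩
    z + y ≈⟨ +-comm z y ⟩
    y + z ∎
    where open ≤-Reasoning

  x<x+y : ∀ x {y} → 0# < y → x < x + y
  x<x+y x {y} 0<y = begin-strict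
    x       ≈⟨ +-identityʳ x ⟨
    x + 0#  <⟨ +-monoʳ-< x 0<y ⟩
    x + y   ∎
    where open ≤-Reasoning

  x<y⇒0<y-x : ∀ {x y} → x < y → 0# < y - x
  x<y⇒0<y-x {x} {y} x<y = begin-strict
    0#       ≈⟨ -‿inverseˡ x ⟨
    - x + x  <⟨ +-monoʳ-< (- x) x<y ⟩
    - x + y  ≈⟨ +-comm (- x) y ⟩
    y - x    ∎
    where open ≤-Reasoning

  x+[y-x]≈y : ∀ x y → x + (y - x) ≈ y
  x+[y-x]≈y x y = ≈-trans (+-congˡ (+-comm y (- x)))
    (≈-trans (≈-sym (+-assoc x (- x) y))
      (≈-trans (+-congʳ (-‿inverseʳ x)) (+-identityˡ y)))

  *-monoʳ-<-pos : ∀ {z} → 0# < z → ∀ {x y} → x < y → z * x < z * y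
  *-monoʳ-<-pos {z} 0<z {x} {y} x<y = begin-strict
    z * x                ≈⟨ +-identityʳ _ ⟨
    z * x + 0#           <⟨ +-monoʳ-< (z * x) (*-pos 0<z (x<y⇒0<y-x x<y)) ⟩
    z * x + z * (y - x)  ≈⟨ distribˡ z x (y - x) ⟨
    z * (x + (y - x))    ≈⟨ *-congˡ (x+[y-x]≈y x y) ⟩
    z * y                ∎
    where open ≤-Reasoning

  *-cancelˡ-<-pos : ∀ {z} → 0# < z → ∀ {x y} → z * x < z * y → x < y
  *-cancelˡ-<-pos {z} 0<z {x} {y} p with #⇒invertible (inj₂ 0<z)
  ... | w , w[z-0]≈1 , _ = begin-strict
    x            ≈⟨ w[zx]≈x x ⟨
    w * (z * x)  <⟨ *-monoʳ-<-pos 0<w p ⟩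
    w * (z * y)  ≈⟨ w[zx]≈x y ⟩
    y            ∎
    where
    open ≤-Reasoning

    z-0≈z : z - 0# ≈ z
    z-0≈z = ≈-trans (+-congˡ -0#≈0#) (+-identityʳ z)

    wz≈1 : w * z ≈ 1#
    wz≈1 = ≈-trans (*-congˡ (≈-sym z-0≈z)) w[z-0]≈1

    w[zx]≈x : ∀ x → w * (z * x) ≈ x
    w[zx]≈x x = ≈-trans (≈-sym (*-assoc w z x)) (≈-trans (*-congʳ wz≈1) (*-identityˡ x))

    zw≈1 : z * w ≈ 1#
    zw≈1 = ≈-trans (*-comm z w) wz≈1

    w-0≈w : w - 0# ≈ w
    w-0≈w = ≈-trans (+-congˡ -0#≈0#) (+-identityʳ w)

    0<w : 0# < w
    0<w with invertible⇒# (z , ≈-trans (*-congˡ w-0≈w) zw≈1 , ≈-trans (*-congʳ w-0≈w) wz≈1)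
    ... | inj₂ 0<w = 0<w
    ... | inj₁ w<0 = ⊥-elim (<-asym 0<z z<0)
      where
      1<0 : 1# < 0#
      1<0 = begin-strict
        1#      ≈⟨ zw≈1 ⟨
        z * w   <⟨ *-monoʳ-<-pos 0<z w<0 ⟩
        z * 0#  ≈⟨ zeroʳ z ⟩
        0#      ∎

      z<0 : z < 0#
      z<0 = begin-strict
        z       ≈⟨ *-identityʳ z ⟨
        z * 1#  <⟨ *-monoʳ-<-pos 0<z 1<0 ⟩
        z * 0#  ≈⟨ zeroʳ z ⟩
        0#      ∎

  *-monoʳ-≤-pos : ∀ {z} → 0# < z → ∀ {x y} → x ≤ y → z * x ≤ z * y
  *-monoʳ-≤-pos 0<z x≤y p = x≤y (*-cancelˡ-<-pos 0<z p)

  -‿mono-< : ∀ {x y} → x < y → - y < - x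
  -‿mono-< {x} {y} x<y = +-cancelˡ-< (x + y) (begin-strict
    x + y + - y    ≈⟨ +-assoc x y (- y) ⟩
    x + (y + - y)  ≈⟨ +-congˡ (-‿inverseʳ y) ⟩
    x + 0#         ≈⟨ +-identityʳ x ⟩
    x              <⟨ x<y ⟩
    y              ≈⟨ +-identityʳ y ⟨
    y + 0#         ≈⟨ +-congˡ (-‿inverseʳ x) ⟨
    y + (x + - x)  ≈⟨ +-assoc y x (- x) ⟨
    y + x + - x    ≈⟨ +-congʳ (+-comm y x) ⟩
    x + y + - x    ∎)
    where open ≤-Reasoning

record DiscountFactor {c ℓ₁ ℓ₂} (ℝ : RealNumbers c ℓ₁ ℓ₂) : Set (c ⊔ ℓ₂) where
  open RealNumbers ℝ
  field
    γ   : Carrier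
    0<γ : 0# < γ
    γ<1 : γ < 1#

module DiscountedSeries
  {c ℓ₁ ℓ₂} (ℝ : RealNumbers c ℓ₁ ℓ₂) (δ : DiscountFactor ℝ)
  where

  open RealNumbers ℝ
  open DiscountFactor δ
  open OrderProperties ℝ
  open SemiringExp semiring public using (_^_)
  open SemiringMult semiring using () renaming (_×_ to _·_)

  partialSum : (ℕ → Carrier) → ℕ → Carrier
  partialSum a zero    = 0#
  partialSum a (suc n) = partialSum a n + γ ^ n * a n

  Bounded : (ℕ → Carrier) → Set ℓ₂
  Bounded a = ∀ t → (a t ≤ 1#) × (- a t ≤ 1#)

  private
    0<1 : 0# < 1#
    0<1 = <-trans 0<γ γ<1

    d : Carrier
    d = 1# - γ

    0<d : 0# < d
    0<d = x<y⇒0<y-x γ<1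

    γ+d≈1 : γ + d ≈ 1#
    γ+d≈1 = x+[y-x]≈y γ 1#

    0<γ^ : ∀ n → 0# < γ ^ n
    0<γ^ zero    = 0<1
    0<γ^ (suc n) = *-pos 0<γ (0<γ^ n)

    open ≤-Reasoning
    open SemiringSolver commutativeSemiring using (solve; _:+_; _:*_; _:=_)

    dg+γg≈g : ∀ g → d * g + γ * g ≈ g
    dg+γg≈g g = begin-equality
      d * g + γ * g  ≈⟨ solve 3 (λ d γ g → d :* g :+ γ :* g := (γ :+ d) :* g) ≈-refl d γ g ⟩
      (γ + d) * g    ≈⟨ *-congʳ γ+d≈1 ⟩
      1# * g         ≈⟨ *-identityˡ g ⟩
      g              ∎

    γg≤g : ∀ {g} → 0# < g → γ * g ≤ g
    γg≤g {g} 0<g = <⇒≤ (begin-strict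
      γ * g          <⟨ x<x+y (γ * g) (*-pos 0<d 0<g) ⟩
      γ * g + d * g  ≈⟨ +-comm _ _ ⟩
      d * g + γ * g  ≈⟨ dg+γg≈g g ⟩
      g              ∎)

    γ^-antitone : ∀ n k → γ ^ (k ℕ.+ n) ≤ γ ^ n
    γ^-antitone n zero    = ≤-reflexive ≈-refl
    γ^-antitone n (suc k) = ≤-trans (γg≤g (0<γ^ (k ℕ.+ n))) (γ^-antitone n k)

    ·-mono-≤ : ∀ n {x y} → x ≤ y → n · x ≤ n · y
    ·-mono-≤ zero    x≤y = ≤-reflexive ≈-refl
    ·-mono-≤ (suc n) {x} {y} x≤y = begin
      x + n · x  ≤⟨ +-monoˡ-≤ (n · x) x≤y ⟩
      y + n · x  ≤⟨ +-monoʳ-≤ y (·-mono-≤ n x≤y) ⟩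
      y + n · y  ∎

    ·-cancel-< : ∀ n {x y} → n · x < n · y → x < y
    ·-cancel-< zero    p = ⊥-elim (<-irrefl ≈-refl p)
    ·-cancel-< (suc n) {x} {y} p with <-cotrans p (n · x + y)
    ... | inj₁ q = +-cancelˡ-< (n · x) (begin-strict
      n · x + x  ≈⟨ +-comm _ _ ⟩
      x + n · x  <⟨ q ⟩
      n · x + y  ∎)
    ... | inj₂ q = ·-cancel-< n (+-cancelˡ-< y (begin-strict
      y + n · x  ≈⟨ +-comm _ _ ⟩
      n · x + y  <⟨ q ⟩
      y + n · y  ∎))

    n[dγⁿ]+γⁿ≤1 : ∀ n → n · (d * γ ^ n) + γ ^ n ≤ 1#
    n[dγⁿ]+γⁿ≤1 zero    = ≤-reflexive (+-identityˡ 1#)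
    n[dγⁿ]+γⁿ≤1 (suc n) = begin
      suc n · (d * (γ * g)) + γ * g  ≤⟨ +-monoˡ-≤ _ (·-mono-≤ (suc n) (*-monoʳ-≤-pos 0<d (γg≤g (0<γ^ n)))) ⟩
      (d * g + n · (d * g)) + γ * g  ≈⟨ solve 3 (λ p q r → (p :+ q) :+ r := q :+ (p :+ r)) ≈-refl _ _ _ ⟩
      n · (d * g) + (d * g + γ * g)  ≈⟨ +-congˡ (dg+γg≈g g) ⟩
      n · (d * g) + g                ≤⟨ n[dγⁿ]+γⁿ≤1 n ⟩
      1#                             ∎
      where
      g : Carrier
      g = γ ^ n

    γⁿ⟶0 : ∀ {ε} → 0# < ε → ∃[ N ] ∀ n → N ℕ.≤ n → γ ^ n < ε
    γⁿ⟶0 {ε} 0<ε with archimedean 1# (*-pos 0<d 0<ε)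
    ... | N , 1<N[dε] = N , γⁿ<ε
      where
      γᴺ<ε : γ ^ N < ε
      γᴺ<ε = *-cancelˡ-<-pos 0<d (·-cancel-< N (begin-strict
        N · (d * γ ^ N)          <⟨ x<x+y _ (0<γ^ N) ⟩
        N · (d * γ ^ N) + γ ^ N  ≤⟨ n[dγⁿ]+γⁿ≤1 N ⟩
        1#                       <⟨ 1<N[dε] ⟩
        N · (d * ε)              ∎))

      γⁿ<ε : ∀ n → N ℕ.≤ n → γ ^ n < ε
      γⁿ<ε n N≤n = ≡.subst (λ m → γ ^ m < ε) (ℕ.m∸n+n≡m N≤n)
        (≤-<-trans (γ^-antitone N (n ℕ.∸ N)) γᴺ<ε)

    γ*-mono-≤1 : ∀ {g x} → 0# < g → x ≤ 1# → g * x ≤ g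
    γ*-mono-≤1 {g} {x} 0<g x≤1 = begin
      g * x   ≤⟨ *-monoʳ-≤-pos 0<g x≤1 ⟩
      g * 1#  ≈⟨ *-identityʳ g ⟩
      g       ∎

    tail-≤ : ∀ {a} → (∀ t → a t ≤ 1#) → ∀ m k →
             d * partialSum a (k ℕ.+ m) + γ ^ (k ℕ.+ m) ≤ d * partialSum a m + γ ^ m
    tail-≤ a≤1 m zero    = ≤-reflexive ≈-refl
    tail-≤ {a} a≤1 m (suc k) = begin
      d * (p + g * x) + γ * g    ≈⟨ +-congʳ (distribˡ d p (g * x)) ⟩
      d * p + d * (g * x) + γ * g ≤⟨ +-monoˡ-≤ _ (+-monoʳ-≤ _ (*-monoʳ-≤-pos 0<d (γ*-mono-≤1 (0<γ^ n) (a≤1 n)))) ⟩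
      d * p + d * g + γ * g      ≈⟨ +-assoc _ _ _ ⟩
      d * p + (d * g + γ * g)    ≈⟨ +-congˡ (dg+γg≈g g) ⟩
      d * p + g                  ≤⟨ tail-≤ a≤1 m k ⟩
      d * partialSum a m + γ ^ m ∎
      where
      n : ℕ
      n = k ℕ.+ m
      p g x : Carrier
      p = partialSum a n
      g = γ ^ n
      x = a n

    tail-< : ∀ {a ε m n} → (∀ t → a t ≤ 1#) → m ℕ.≤ n → γ ^ m < d * ε →
             partialSum a n < partialSum a m + ε
    tail-< {a} {ε} {m} {n} a≤1 m≤n γᵐ<dε = *-cancelˡ-<-pos 0<d (begin-strict
      d * partialSum a n            <⟨ x<x+y _ (0<γ^ n) ⟩
      d * partialSum a n + γ ^ n    ≤⟨ tail ⟩
      d * partialSum a m + γ ^ m    <⟨ +-monoʳ-< _ γᵐ<dε ⟩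
      d * partialSum a m + d * ε    ≈⟨ distribˡ d _ ε ⟨
      d * (partialSum a m + ε)      ∎)
      where
      tail : d * partialSum a n + γ ^ n ≤ d * partialSum a m + γ ^ m
      tail = ≡.subst (λ l → d * partialSum a l + γ ^ l ≤ d * partialSum a m + γ ^ m)
        (ℕ.m∸n+n≡m m≤n) (tail-≤ a≤1 m (n ℕ.∸ m))

    partialSum-neg : ∀ a n → partialSum (-_ ∘ a) n ≈ - partialSum a n
    partialSum-neg a zero    = ≈-sym -0#≈0#
    partialSum-neg a (suc n) = begin-equality
      partialSum (-_ ∘ a) n + γ ^ n * - a n   ≈⟨ +-cong (partialSum-neg a n) (≈-sym (-‿distribʳ-* _ _)) ⟩
      - partialSum a n + - (γ ^ n * a n)      ≈⟨ -‿+-comm _ _ ⟩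
      - (partialSum a n + γ ^ n * a n)        ∎

    tail-within : ∀ {a ε m n} → Bounded a → m ℕ.≤ n → γ ^ m < d * ε →
                  Within ε (partialSum a n) (partialSum a m)
    tail-within {a} {ε} {m} {n} bd m≤n γᵐ<dε =
      tail-< (proj₁ ∘ bd) m≤n γᵐ<dε , +-cancelˡ-< (- q + - p) (begin-strict
        - q + - p + p        ≈⟨ +-assoc (- q) (- p) p ⟩
        - q + (- p + p)      ≈⟨ +-congˡ (-‿inverseˡ p) ⟩
        - q + 0#             ≈⟨ +-identityʳ (- q) ⟩
        - q                  ≈⟨ partialSum-neg a n ⟨
        partialSum (-_ ∘ a) n     <⟨ tail-< (proj₂ ∘ bd) m≤n γᵐ<dε ⟩
        partialSum (-_ ∘ a) m + ε ≈⟨ +-congʳ (partialSum-neg a m) ⟩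
        - p + ε              ≈⟨ +-congʳ (+-identityʳ (- p)) ⟨
        - p + 0# + ε         ≈⟨ +-congʳ (+-congˡ (-‿inverseˡ q)) ⟨
        - p + (- q + q) + ε  ≈⟨ solve 4 (λ p' q' q ε → p' :+ (q' :+ q) :+ ε := q' :+ p' :+ (q :+ ε)) ≈-refl (- p) (- q) q ε ⟩
        - q + - p + (q + ε)  ∎)
      where
      p q : Carrier
      p = partialSum a m
      q = partialSum a n

  partialSum-cauchy : ∀ a → Bounded a → Cauchy (partialSum a)
  partialSum-cauchy a bd ε 0<ε with γⁿ⟶0 (*-pos 0<d 0<ε)
  ... | N , γⁿ<dε = N , close
    where
    close : ∀ m n → N ℕ.≤ m → N ℕ.≤ n → Within ε (partialSum a m) (partialSum a n)
    close m n N≤m N≤n with ℕ.≤-total m n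
    ... | inj₁ m≤n = let u , v = tail-within bd m≤n (γⁿ<dε m N≤m) in v , u
    ... | inj₂ n≤m = tail-within bd n≤m (γⁿ<dε n N≤n)

  -- Σₜ γᵗ aₜ; the bound ∣aₜ∣ ≤ 1 guarantees convergence.
  discountedSum : ∀ a → Bounded a → Carrier
  discountedSum a bd = proj₁ (complete (partialSum a) (partialSum-cauchy a bd))

-- A graph has at least one vertex (with no vertices there are no initial states
-- of the three-player game, and zero cops would win).  Adjacency is decidable,
-- as it always is classically.

record Graph : Set₁ where
  field
    order       : ℕ
    {{nonEmpty}} : ℕ.NonZero order

  V : Set
  V = Fin order

  field
    Adj    : Rel V 0ℓ
    sym    : Symmetric Adj
    irrefl : Irreflexive _≡_ Adj
    adj?   : Decidable Adj

  infix 4 _∈N[_]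

  _∈N[_] : V → V → Set
  y ∈N[ x ] = y ≡ x ⊎ Adj x y

module CopsAndRobbers (G : Graph) (k : ℕ) where

  open Graph G

  Cops : Set
  Cops = Vec V k

  Position : Set
  Position = Cops × V

  CopMove : Cops → Set
  CopMove c = ∃[ c′ ] ∀ i → lookup c′ i ∈N[ lookup c i ]

  RobberMove : V → Set
  RobberMove r = ∃[ r′ ] r′ ∈N[ r ]

  -- Moves may depend on the whole list of past positions, one for each
  -- half-round, oldest first.

  record CopStrategy : Set where
    field
      place : Cops
      move  : List Position → ((c , r) : Position) → CopMove c

  record RobberStrategy : Set where
    field
      place : Cops → V
      move  : List Position → ((c , r) : Position) → RobberMove r

  data Side : Set where
    cops robber : Side

  module _ (κ : CopStrategy) (ρ : RobberStrategy) where
    private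
      module κ = CopStrategy κ
      module ρ = RobberStrategy ρ

    -- the side to move, the past positions and the current position
    -- after t half-rounds
    play : ℕ → Side × List Position × Position
    play zero = cops , [] , (κ.place , ρ.place κ.place)
    play (suc t) with play t
    ... | cops   , h , (c , r) = robber , h ∷ʳ (c , r) , (proj₁ (κ.move h (c , r)) , r)
    ... | robber , h , (c , r) = cops   , h ∷ʳ (c , r) , (c , proj₁ (ρ.move h (c , r)))

    position : ℕ → Position
    position t = proj₂ (proj₂ (play t))

    Captured : Set
    Captured = ∃[ t ] let (c , r) = position t in r ∈ᵛ c

  CopsWin : Set
  CopsWin = ∃[ κ ] ∀ ρ → Captured κ ρ

IsCopNumber : Graph → ℕ → Set
IsCopNumber G k = CopsWin k × (∀ j → CopsWin j → k ℕ.≤ j)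
  where open CopsAndRobbers G using (CopsWin)

Player : Set
Player = Fin 3

pattern P₁ = zero
pattern P₂ = suc zero
pattern P₃ = suc (suc zero)

next : Player → Player
next P₁ = P₂
next P₂ = P₃
next P₃ = P₁

module Γ₃ (G : Graph) where

  open Graph G

  S : Set
  S = Vec V 3 × Player

  data State : Set where
    ⟪_⟫ : S → State
    s̄   : State

  S̃¹ S̃² S-C : S → Set
  S̃¹ (x , _) = lookup x P₁ ≡ lookup x P₂
  S̃² (x , _) = lookup x P₂ ≡ lookup x P₃
  S-C s = S̃¹ s ⊎ S̃² s

  S̃¹? : ∀ s → Dec (S̃¹ s)
  S̃¹? (x , _) = lookup x P₁ Fin.≟ lookup x P₂

  S̃²? : ∀ s → Dec (S̃² s)
  S̃²? (x , _) = lookup x P₂ Fin.≟ lookup x P₃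

  data Action : Set where
    to : V → Action
    λ∅ : Action            -- the null move

  infix 4 _∈A[_]_

  data _∈A[_]_ : Action → Player → State → Set where
    go   : ∀ {x p y} → ¬ S-C (x , p) → y ∈N[ lookup x p ] → to y ∈A[ p ] ⟪ x , p ⟫
    stay : ∀ {x p m} → ¬ S-C (x , p) → m ≢ p → to (lookup x m) ∈A[ m ] ⟪ x , p ⟫
    null : ∀ {s m} → S-C s → λ∅ ∈A[ m ] ⟪ s ⟫
    end  : ∀ {m} → λ∅ ∈A[ m ] s̄

  -- Only applied to an action available to the player who has the move, so
  -- that the second clause is used only in capture states and the third only
  -- with the null move.
  T : State → Action → State
  T ⟪ x , p ⟫ (to y) = ⟪ x [ p ]≔ y , next p ⟫
  T ⟪ _ ⟫     λ∅     = s̄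
  T s̄         _      = s̄

  -- A finite history s₀ s₁ … sₜ is given by the list s₀ … sₜ₋₁ and sₜ.
  Strategy : Player → Set
  Strategy n = List State → (sₜ : State) → ∃[ a ] a ∈A[ n ] sₜ

  Profile : Set
  Profile = ∀ n → Strategy n

  infixl 6 _[_↦_]

  _[_↦_] : Profile → ∀ n → Strategy n → Profile
  (σ [ n ↦ τ ]) m with n Fin.≟ m
  ... | yes refl = τ
  ... | no  _    = σ m

  step : Profile → List State → State → State
  step σ h ⟪ x , p ⟫ = T ⟪ x , p ⟫ (proj₁ (σ p h ⟪ x , p ⟫))
  step σ h s̄         = T s̄ λ∅

  history : S → Profile → ℕ → List State × State
  history s₀ σ zero = [] , ⟪ s₀ ⟫
  history s₀ σ (suc t) = let (h , s) = history s₀ σ t in h ∷ʳ s , step σ h s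

  play : S → Profile → ℕ → State
  play s₀ σ t = proj₂ (history s₀ σ t)

  module Payoffs
    {c ℓ₁ ℓ₂} (ℝ : RealNumbers c ℓ₁ ℓ₂) (δ : DiscountFactor ℝ)
    where

    open RealNumbers ℝ
    open DiscountFactor δ
    open DiscountedSeries ℝ δ

    q : Player → State → Carrier
    q _  s̄     = 0#
    q P₁ ⟪ s ⟫ = if does (S̃¹? s) then 1# else 0#
    q P₂ ⟪ s ⟫ = if does (S̃¹? s) then - 1# else
                 if does (S̃²? s) then 1#   else 0#
    q P₃ ⟪ s ⟫ = if does (S̃¹? s) then 0#   else
                 if does (S̃²? s) then - 1# else 0#

    q-bounded : ∀ n s → (q n s ≤ 1#) × (- q n s ≤ 1#)
    q-bounded = bounded
      where
      open OrderProperties ℝ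

      0<1 : 0# < 1#
      0<1 = <-trans 0<γ γ<1

      -1<0 : - 1# < 0#
      -1<0 = <-≤-trans (-‿mono-< 0<1) (≤-reflexive -0#≈0#)

      0-ok : (0# ≤ 1#) × (- 0# ≤ 1#)
      0-ok = <⇒≤ 0<1 , <⇒≤ (≤-<-trans (≤-reflexive -0#≈0#) 0<1)

      1-ok : (1# ≤ 1#) × (- 1# ≤ 1#)
      1-ok = ≤-reflexive ≈-refl , <⇒≤ (<-trans -1<0 0<1)

      -1-ok : (- 1# ≤ 1#) × (- - 1# ≤ 1#)
      -1-ok = <⇒≤ (<-trans -1<0 0<1) , ≤-reflexive (-‿involutive 1#)

      bounded : ∀ n s → (q n s ≤ 1#) × (- q n s ≤ 1#)
      bounded _  s̄     = 0-ok
      bounded P₁ ⟪ s ⟫ with does (S̃¹? s)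
      ... | true  = 1-ok
      ... | false = 0-ok
      bounded P₂ ⟪ s ⟫ with does (S̃¹? s) | does (S̃²? s)
      ... | true  | _     = -1-ok
      ... | false | true  = 1-ok
      ... | false | false = 0-ok
      bounded P₃ ⟪ s ⟫ with does (S̃¹? s) | does (S̃²? s)
      ... | true  | _     = 0-ok
      ... | false | true  = -1-ok
      ... | false | false = 0-ok

    Q : Player → S → Profile → Carrier
    Q n s₀ σ = discountedSum (λ t → q n (play s₀ σ t)) (λ t → q-bounded n (play s₀ σ t))

    IsNashEquilibrium : S → Profile → Set ℓ₂
    IsNashEquilibrium s₀ σ̂ = ∀ n (σⁿ : Strategy n) → Q n s₀ σ̂ ≥ Q n s₀ (σ̂ [ n ↦ σⁿ ])

    -- K₃ s₀ σ k means that the capture function takes the value k at σ; as a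
    -- function it would have to decide whether a capture ever happens.
    data K₃ (s₀ : S) (σ : Profile) : ℕ → Set (ℓ₁ ⊔ ℓ₂) where
      no-capture  : Q P₁ s₀ σ ≈ 0# → Q P₂ s₀ σ ≈ 0# → Q P₃ s₀ σ ≈ 0# → K₃ s₀ σ 0
      P₁-captures : Q P₁ s₀ σ > 0# → K₃ s₀ σ 1
      P₂-captures : Q P₂ s₀ σ > 0# → K₃ s₀ σ 2

{-# OPTIONS --safe #-}

-- The game is zero-sum.  If one cop cannot win, there are positions
-- with the cop to move from which the robber evades forever; place x² safely
-- against x¹ and x³ safely against x², with P₁ to move.  By evading their
-- pursuers P₂ and P₃ can each secure a nonnegative total payoff, so at an
-- equilibrium all three payoffs are nonnegative with sum 0, hence none of them is
-- positive.

module Submission where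

open import Defs
import Algebra.Solver.Ring.NaturalCoefficients.Default as SemiringSolver
open import Data.Bool.Base using (true; false)
open import Data.Empty using (⊥; ⊥-elim)
open import Data.Fin.Base using (Fin; zero; suc; toℕ; fromℕ<; combine; remQuot)
open import Data.Fin.Properties as Fin using (any?; all?; ¬∀⟶∃¬; pigeonhole; remQuot-combine)
open import Data.List.Base using (_∷ʳ_)
open import Data.Nat.Base as ℕ using (ℕ; zero; suc; s≤s)
import Data.Nat.Properties as ℕ
open import Data.Product.Base using (∃-syntax; _×_; _,_; proj₁; proj₂; uncurry)
open import Data.Sum.Base using (_⊎_; inj₁; inj₂; map₂; fromInj₁)
open import Data.Vec.Base using (Vec; []; _∷_; lookup; _[_]≔_)
open import Data.Vec.Membership.Propositional using () renaming (_∈_ to _∈ᵛ_; _∉_ to _∉ᵛ_)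
open import Data.Vec.Properties using (lookup∘update; lookup∘update′)
open import Data.Vec.Relation.Unary.Any using (here)
open import Function.Base using (_∘_)
open import Relation.Binary.PropositionalEquality
  using (_≡_; _≢_; refl; sym; cong; subst; subst₂; module ≡-Reasoning)
open import Relation.Nullary.Decidable
  using (Dec; yes; no; does; ¬?; decidable-stable; _×-dec_; _⊎-dec_; _→-dec_)
open import Relation.Nullary.Negation using (¬_; contradiction)
open import Relation.Unary using (Pred; Decidable; _⊆_)
open import Level using (0ℓ)

-- Increasing chains of decidable subsets of a finite set.

increasing⇒mono :
  ∀ {A : Set} (P : ℕ → Pred A 0ℓ) → (∀ n → P n ⊆ P (suc n)) →
  ∀ {m n} → m ℕ.≤ n → P m ⊆ P n
increasing⇒mono P increasing m≤n = mono (ℕ.≤⇒≤′ m≤n)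
  where
  mono : ∀ {m n} → m ℕ.≤′ n → P m ⊆ P n
  mono (ℕ.≤′-reflexive refl) p = p
  mono (ℕ.≤′-step m≤n)       p = increasing _ (mono m≤n p)

-- If each of the first `suc m` steps added a new element, by the pigeonhole principle two steps
-- `k < l` would add the same one. But what enters at step `k` already lies in `P l`.
increasing-stabilises :
  ∀ {m} (P : ℕ → Pred (Fin m) 0ℓ) → (∀ n → Decidable (P n)) →
  (∀ n → P n ⊆ P (suc n)) → ∃[ n ] P (suc n) ⊆ P n
increasing-stabilises {m} P P? increasing with any? stable?
  where
  stable? : ∀ (k : Fin (suc m)) → Dec (∀ i → P (suc (toℕ k)) i → P (toℕ k) i)
  stable? k = all? λ i → P? _ i →-dec P? _ i
... | yes (k , stable) = toℕ k , λ {i} → stable i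
... | no unstable =
  let k , l , k<l , same = pigeonhole (ℕ.n<1+n m) (proj₁ ∘ new)
      P[1+k] , _ = proj₂ (new k)
      _ , ¬P[l]  = proj₂ (new l)
  in contradiction (subst (P (toℕ l)) same (increasing⇒mono P increasing k<l P[1+k])) ¬P[l]
  where
  new : ∀ (k : Fin (suc m)) → ∃[ i ] P (suc (toℕ k)) i × ¬ P (toℕ k) i
  new k =
    let i , ¬stable = ¬∀⟶∃¬ m _ (λ i → P? _ i →-dec P? _ i) (λ stable → unstable (k , stable))
    in i , decidable-stable (P? _ i) (λ ¬p → ¬stable (⊥-elim ∘ ¬p)) , (λ p → ¬stable (λ _ → p))

-- Zero cops, and evasion of a single cop.

∉[] : ∀ {A : Set} {x : A} (xs : Vec A 0) → x ∉ᵛ xs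
∉[] [] ()

module _ (G : Graph) where

  open Graph G hiding (sym)

  ¬CopsWin0 : ¬ CopsAndRobbers.CopsWin G 0
  ¬CopsWin0 (κ , κ-wins) = let _ , r∈[] = κ-wins idle in ∉[] _ r∈[]
    where
    open CopsAndRobbers G 0
    idle : RobberStrategy
    idle = record
      { place = λ _ → fromℕ< (ℕ.>-nonZero⁻¹ order)
      ; move  = λ { _ (_ , r) → r , inj₁ refl }
      }

  -- Safe c r: with the cop at c to move, the robber at r is never caught if he
  -- answers every cop position c′ by moving to dodge c′ r.
  record Evasion : Set₁ where
    field
      Safe    : V → V → Set
      dodge   : V → V → V
      start   : ∀ c → ∃[ r ] Safe c r
      dodge∈N : ∀ c r → dodge c r ∈N[ r ]
      evades  : ∀ {c r c′} → Safe c r → c′ ∈N[ c ] → c′ ≢ r × Safe c′ (dodge c′ r)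

-- Determinacy of the game with one cop.

module SingleCop (G : Graph) where

  open Graph G hiding (sym)
  open CopsAndRobbers G 1

  _∈N?[_] : ∀ y x → Dec (y ∈N[ x ])
  y ∈N?[ x ] = (y Fin.≟ x) ⊎-dec adj? x y

  -- The cop, at c and to move, captures the robber at r within n moves.
  Wins : ℕ → V → V → Set
  Wins zero    c r = ⊥
  Wins (suc n) c r =
    ∃[ c′ ] c′ ∈N[ c ] × (c′ ≡ r ⊎ (∀ r′ → r′ ∈N[ r ] → Wins n c′ r′))

  Wins? : ∀ n c r → Dec (Wins n c r)
  Wins? zero    c r = no λ ()
  Wins? (suc n) c r = any? λ c′ → (c′ ∈N?[ c ]) ×-dec
    ((c′ Fin.≟ r) ⊎-dec all? λ r′ → (r′ ∈N?[ r ]) →-dec Wins? n c′ r′)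

  Wins-suc : ∀ n {c r} → Wins n c r → Wins (suc n) c r
  Wins-suc (suc n) (c′ , c′∈N , caught-or-wins) =
    c′ , c′∈N , map₂ (λ wins r′ r′∈N → Wins-suc n (wins r′ r′∈N)) caught-or-wins

  Wins-mono : ∀ {m n c r} → m ℕ.≤ n → Wins m c r → Wins n c r
  Wins-mono m≤n = increasing⇒mono (λ n → uncurry (Wins n)) (λ n → Wins-suc n) m≤n

  -- Pairs of vertices are coded as elements of `Fin (order * order)`, so that the winning positions
  -- form an increasing chain in a finite set.
  Wins-stabilises : ∃[ n ] ∀ c r → Wins (suc n) c r → Wins n c r
  Wins-stabilises =
    let n , stable = increasing-stabilises {order ℕ.* order}
          (λ n → uncurry (Wins n) ∘ remQuot order) (λ n _ → Wins? n _ _) (λ n → Wins-suc n)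
    in n , λ c r → subst (λ cr → uncurry (Wins (suc n)) cr → uncurry (Wins n) cr)
             (remQuot-combine c r) (stable {combine c r})

  -- The move comes from the least number of rounds in which the cop can win,
  -- so this number decreases along the play.
  chase : ℕ → ∀ c (r : V) → ∃[ c′ ] c′ ∈N[ c ]
  chase zero    c r = c , inj₁ refl
  chase (suc n) c r with Wins? n c r | Wins? (suc n) c r
  ... | yes _ | _                   = chase n c r
  ... | no  _ | yes (c′ , c′∈N , _) = c′ , c′∈N
  ... | no  _ | no  _               = c , inj₁ refl

  -- `chase N` does not know `n`. It plays for the fastest win, which leaves at most `n` further
  -- moves, and `Wins` is monotone.
  chase-progress : ∀ N {n c r} → n ℕ.< N → Wins (suc n) c r →
    let c′ , _ = chase N c r in c′ ≡ r ⊎ (∀ r′ → r′ ∈N[ r ] → Wins n c′ r′)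
  chase-progress (suc N) {n} {c} {r} (s≤s n≤N) wins
    with Wins? N c r | Wins? (suc N) c r | ℕ.m≤n⇒m<n∨m≡n n≤N
  ... | yes _      | _                            | inj₁ n<N  = chase-progress N n<N wins
  ... | no ¬wins-N | _                            | inj₁ n<N  = contradiction (Wins-mono n<N wins) ¬wins-N
  ... | no _       | yes (_ , _ , caught-or-wins) | inj₂ refl = caught-or-wins
  ... | no _       | no ¬wins                     | inj₂ refl = contradiction wins ¬wins
  -- Here `n` is `suc M` and the cop can already win in `n` moves, so the chase leaves a win in `M`
  -- moves, weakened to `n`. For `n = 0` this case is void, since `Wins zero` is empty.
  chase-progress (suc (suc M)) _ _ | yes wins-N | _ | inj₂ refl =
    map₂ (λ wins′ r′ r′∈N → Wins-suc M (wins′ r′ r′∈N)) (chase-progress (suc M) ℕ.≤-refl wins-N)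

  module _ (N : ℕ) (c₀ : V) where

    chaseStrategy : CopStrategy
    chaseStrategy = record
      { place = c₀ ∷ []
      ; move  = λ { _ (c ∷ [] , r) → let c′ , c′∈N = chase N c r in
                    (c′ ∷ []) , λ { zero → c′∈N } }
      }

    module _ (ρ : RobberStrategy) where

      open RobberStrategy ρ using (move)

      -- Starting at an arbitrary half-round `t` lets the induction on `n` advance the play by one
      -- cop move and one robber move, while `N` stays fixed in the strategy.
      chase-captures : ∀ n t {h c r} → n ℕ.≤ N →
        play chaseStrategy ρ t ≡ (cops , h , (c ∷ [] , r)) →
        Wins n c r → Captured chaseStrategy ρ
      chase-captures (suc n) t {h} {c} {r} n<N at-t wins
        with chase-progress N n<N wins
      ... | inj₁ caught = suc t , captured
        where
        captured : let cs , r = position chaseStrategy ρ (suc t) in r ∈ᵛ cs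
        captured rewrite at-t = here (sym caught)
      ... | inj₂ wins′ =
        chase-captures n (suc (suc t)) (ℕ.<⇒≤ n<N) at-2+t (wins′ _ (proj₂ robberMove))
        where
        c′ = proj₁ (chase N c r)
        robberMove = move (h ∷ʳ (c ∷ [] , r)) (c′ ∷ [] , r)

        at-2+t : play chaseStrategy ρ (suc (suc t)) ≡
          (cops , h ∷ʳ (c ∷ [] , r) ∷ʳ (c′ ∷ [] , r) , (c′ ∷ [] , proj₁ robberMove))
        at-2+t rewrite at-t = refl

  module _ (N : ℕ) (stable : ∀ c r → Wins (suc N) c r → Wins N c r) where

    -- If after some cop move every robber answer lost within `N` moves, the position before it
    -- would be won within `suc N`, hence by stability within `N`.
    losing⇒evasion : (∀ c → ∃[ r ] ¬ Wins N c r) → Evasion G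
    losing⇒evasion start = record
      { Safe    = λ c r → ¬ Wins N c r
      ; dodge   = dodge
      ; start   = start
      ; dodge∈N = dodge∈N
      ; evades  = evades
      }
      where
      refuge? : ∀ c r → Dec (∃[ r′ ] r′ ∈N[ r ] × ¬ Wins N c r′)
      refuge? c r = any? λ r′ → (r′ ∈N?[ r ]) ×-dec ¬? (Wins? N c r′)

      dodge : V → V → V
      dodge c r with refuge? c r
      ... | yes (r′ , _) = r′
      -- A default value: after a cop move from a safe position a refuge always exists.
      ... | no _         = r

      dodge∈N : ∀ c r → dodge c r ∈N[ r ]
      dodge∈N c r with refuge? c r
      ... | yes (_ , r′∈N , _) = r′∈N
      ... | no _               = inj₁ refl

      evades : ∀ {c r c′} → ¬ Wins N c r → c′ ∈N[ c ] → c′ ≢ r × ¬ Wins N c′ (dodge c′ r)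
      evades {c} {r} {c′} safe c′∈N = (λ caught → ¬wins (inj₁ caught)) , safe′
        where
        ¬wins : ¬ (c′ ≡ r ⊎ (∀ r′ → r′ ∈N[ r ] → Wins N c′ r′))
        ¬wins wins = safe (stable c r (c′ , c′∈N , wins))

        safe′ : ¬ Wins N c′ (dodge c′ r)
        safe′ with refuge? c′ r
        ... | yes (_ , _ , ¬wins′) = ¬wins′
        ... | no ¬refuge = λ _ → ¬wins (inj₂ λ r′ r′∈N →
          decidable-stable (Wins? N c′ r′) (λ ¬w → ¬refuge (r′ , r′∈N , ¬w)))

  -- At the stable `N` the search is finite: either some start for the cop wins against all starts
  -- of the robber, or every start has a safe reply.
  determined : CopsWin ⊎ Evasion G
  determined with Wins-stabilises
  ... | N , stable with any? (λ c → all? (Wins? N c))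
  ... | yes (c , wins) = inj₁ (chaseStrategy N c , λ ρ →
          chase-captures N c ρ N 0 ℕ.≤-refl refl (wins _))
  ... | no ¬wins = inj₂ (losing⇒evasion N stable λ c →
          ¬∀⟶∃¬ order _ (Wins? N c) (λ wins → ¬wins (c , wins)))

-- Evading one pursuer in the three-player game.

next-injective : ∀ {m n} → next m ≡ next n → m ≡ n
next-injective {m} {n} next-m≡next-n = begin
  m                     ≡⟨ next³ m ⟨
  next (next (next m))  ≡⟨ cong (next ∘ next) next-m≡next-n ⟩
  next (next (next n))  ≡⟨ next³ n ⟩
  n                     ∎
  where
  open ≡-Reasoning
  next³ : ∀ p → next (next (next p)) ≡ p
  next³ P₁ = refl
  next³ P₂ = refl
  next³ P₃ = refl

next≢ : ∀ m → next m ≢ m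
next≢ P₁ ()
next≢ P₂ ()
next≢ P₃ ()

module Evade (G : Graph) (ev : Evasion G) (m : Player) where

  open Graph G hiding (sym)
  open Γ₃ G
  open Evasion ev

  private
    n : Player
    n = next m

    n≢m : n ≢ m
    n≢m = next≢ m

  S-C? : ∀ s → Dec (S-C s)
  S-C? s = S̃¹? s ⊎-dec S̃²? s

  evade : Strategy n
  evade _ s̄ = λ∅ , end
  evade _ ⟪ x , p ⟫ with S-C? (x , p) | n Fin.≟ p
  ... | yes s∈C | _        = λ∅ , null s∈C
  ... | no  s∉C | yes refl = to (dodge (lookup x m) (lookup x n)) , go s∉C (dodge∈N _ _)
  ... | no  s∉C | no n≢p   = to (lookup x n) , stay s∉C n≢p

  -- The invariant of the play, with `m` the pursuer and `n` the evader. In `chased` the evader has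
  -- yet to answer, so safety concerns the coming answer and distinctness is recorded apart.
  data Evading : State → Set where
    safe   : ∀ {x p} → p ≢ n → Safe (lookup x m) (lookup x n) → Evading ⟪ x , p ⟫
    chased : ∀ {x} → lookup x m ≢ lookup x n →
             Safe (lookup x m) (dodge (lookup x m) (lookup x n)) → Evading ⟪ x , n ⟫
    over   : Evading s̄

  -- The action is an arbitrary available one, so the invariant survives any strategies of the other
  -- two players.
  Evading-T : ∀ {x p a} → p ≢ n → Safe (lookup x m) (lookup x n) →
              a ∈A[ p ] ⟪ x , p ⟫ → Evading (T ⟪ x , p ⟫ a)
  Evading-T p≢n safe-x (null _)     = over
  Evading-T p≢n safe-x (stay _ p≢p) = contradiction refl p≢p
  Evading-T {x} {p} p≢n safe-x (go {y = y} _ y∈N) with p Fin.≟ m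
  ... | yes refl = chased
    (subst₂ _≢_ (sym at-m) (sym at-n) (proj₁ chase))
    (subst₂ (λ c r → Safe c (dodge c r)) (sym at-m) (sym at-n) (proj₂ chase))
    where
    chase : y ≢ lookup x n × Safe y (dodge y (lookup x n))
    chase = evades safe-x y∈N
    at-m : lookup (x [ m ]≔ y) m ≡ y
    at-m = lookup∘update m x y
    at-n : lookup (x [ m ]≔ y) n ≡ lookup x n
    at-n = lookup∘update′ n≢m x y
  -- The third player moved: the pair is unchanged, and the turn does not pass to `next m`.
  ... | no p≢m = safe (p≢m ∘ next-injective)
    (subst₂ Safe (sym (lookup∘update′ (p≢m ∘ sym) x y)) (sym (lookup∘update′ (p≢n ∘ sym) x y)) safe-x)

  Evading-step : ∀ (σ : Profile) h s → Evading s → Evading (step (σ [ n ↦ evade ]) h s)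
  Evading-step σ h s̄ over = over
  Evading-step σ h ⟪ x , p ⟫ (safe p≢n safe-x) =
    Evading-T p≢n safe-x (proj₂ ((σ [ n ↦ evade ]) p h ⟪ x , p ⟫))
  -- The first test `n Fin.≟ n` evaluates the updated profile, the second the strategy `evade`
  -- itself.
  Evading-step σ h ⟪ x , .n ⟫ (chased m≢n safe-x) with n Fin.≟ n
  ... | no n≢n = contradiction refl n≢n
  ... | yes refl with S-C? (x , n) | n Fin.≟ n
  ...   | yes _ | _        = over
  ...   | no _  | no n≢n   = contradiction refl n≢n
  ...   | no _  | yes refl = safe (next≢ n)
    (subst₂ Safe (sym (lookup∘update′ (n≢m ∘ sym) x _)) (sym (lookup∘update n x _)) safe-x)

  Evading-play : ∀ (σ : Profile) s₀ → Evading ⟪ s₀ ⟫ → ∀ t → Evading (play s₀ (σ [ n ↦ evade ]) t)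
  Evading-play σ s₀ start zero    = start
  Evading-play σ s₀ start (suc t) = Evading-step σ _ _ (Evading-play σ s₀ start t)

  -- In the `safe` case, staying put is a legal move of the pursuer, and it must not capture.
  Evading⇒≢ : ∀ {x p} → Evading ⟪ x , p ⟫ → lookup x m ≢ lookup x n
  Evading⇒≢ (safe _ safe-x) = proj₁ (evades safe-x (inj₁ refl))
  Evading⇒≢ (chased m≢n _)  = m≢n

-- Limits and discounted sums.

module LimitProperties {c ℓ₁ ℓ₂} (ℝ : RealNumbers c ℓ₁ ℓ₂) (δ : DiscountFactor ℝ) where

  open RealNumbers ℝ
  open DiscountFactor δ
  open OrderProperties ℝ
  open DiscountedSeries ℝ δ
  open SemiringSolver commutativeSemiring using (solve; _:+_; _:*_; _:=_)
  open ≤-Reasoning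

  0<1 : 0# < 1#
  0<1 = <-trans 0<γ γ<1

  0<γ^ : ∀ n → 0# < γ ^ n
  0<γ^ zero    = 0<1
  0<γ^ (suc n) = *-pos 0<γ (0<γ^ n)

  +-mono-≤ : ∀ {x y u v} → x ≤ y → u ≤ v → x + u ≤ y + v
  +-mono-≤ {y = y} {u} x≤y u≤v = ≤-trans (+-monoˡ-≤ u x≤y) (+-monoʳ-≤ y u≤v)

  +-mono-< : ∀ {x y u v} → x < y → u < v → x + u < y + v
  +-mono-< {x} {y} {u} {v} x<y u<v = begin-strict
    x + u  ≤⟨ +-monoˡ-≤ u (<⇒≤ x<y) ⟩
    y + u  <⟨ +-monoʳ-< y u<v ⟩
    y + v  ∎

  -- With no halving at hand, ε is split as γ ε + (1 - γ) ε.
  split : ∀ {ε} → 0# < ε → ∃[ ε₁ ] ∃[ ε₂ ] 0# < ε₁ × 0# < ε₂ × ε₁ + ε₂ ≈ ε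
  split {ε} 0<ε = γ * ε , (1# - γ) * ε , *-pos 0<γ 0<ε , *-pos (x<y⇒0<y-x γ<1) 0<ε ,
    (begin-equality
      γ * ε + (1# - γ) * ε  ≈⟨ distribʳ ε γ (1# - γ) ⟨
      (γ + (1# - γ)) * ε    ≈⟨ *-congʳ (x+[y-x]≈y γ 1#) ⟩
      1# * ε                ≈⟨ *-identityˡ ε ⟩
      ε                     ∎)

  ⟶-const : ∀ x → (λ _ → x) ⟶ x
  ⟶-const x ε 0<ε = 0 , λ _ _ → x<x+y x 0<ε , x<x+y x 0<ε

  ⟶-+ : ∀ {s t k l} → s ⟶ k → t ⟶ l → (λ n → s n + t n) ⟶ (k + l)
  ⟶-+ {s} {t} {k} {l} s⟶k t⟶l ε 0<ε with split 0<ε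
  ... | ε₁ , ε₂ , 0<ε₁ , 0<ε₂ , ε₁+ε₂≈ε with s⟶k ε₁ 0<ε₁ | t⟶l ε₂ 0<ε₂
  ... | M , s-near | N , t-near = M ℕ.⊔ N , λ n M⊔N≤n →
    let s<k , k<s = s-near n (ℕ.≤-trans (ℕ.m≤m⊔n M N) M⊔N≤n)
        t<l , l<t = t-near n (ℕ.≤-trans (ℕ.m≤n⊔m M N) M⊔N≤n)
    in add s<k t<l , add k<s l<t
    where
    add : ∀ {x y u v} → x < y + ε₁ → u < v + ε₂ → x + u < y + v + ε
    add {x} {y} {u} {v} p q = begin-strict
      x + u                <⟨ +-mono-< p q ⟩
      (y + ε₁) + (v + ε₂)  ≈⟨ solve 4 (λ y v e f → (y :+ e) :+ (v :+ f) := y :+ v :+ (e :+ f)) ≈-refl y v ε₁ ε₂ ⟩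
      y + v + (ε₁ + ε₂)    ≈⟨ +-congˡ ε₁+ε₂≈ε ⟩
      y + v + ε            ∎

  -- By contradiction: if `l < k`, the gap is split into two tolerances, and at a common late index
  -- the estimates give `k < k`.
  ⟶-mono-≤ : ∀ {s t k l} → s ⟶ k → t ⟶ l → (∀ n → s n ≤ t n) → k ≤ l
  ⟶-mono-≤ {s} {t} {k} {l} s⟶k t⟶l s≤t l<k with split (x<y⇒0<y-x l<k)
  ... | ε₁ , ε₂ , 0<ε₁ , 0<ε₂ , ε₁+ε₂≈k-l with s⟶k ε₂ 0<ε₂ | t⟶l ε₁ 0<ε₁
  ... | M , s-near | N , t-near = <-irrefl ≈-refl (begin-strict
    k              <⟨ proj₂ (s-near n (ℕ.m≤m⊔n M N)) ⟩
    s n + ε₂       ≤⟨ +-monoˡ-≤ ε₂ (s≤t n) ⟩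
    t n + ε₂       ≤⟨ +-monoˡ-≤ ε₂ (<⇒≤ (proj₁ (t-near n (ℕ.m≤n⊔m M N)))) ⟩
    l + ε₁ + ε₂    ≈⟨ +-assoc l ε₁ ε₂ ⟩
    l + (ε₁ + ε₂)  ≈⟨ +-congˡ ε₁+ε₂≈k-l ⟩
    l + (k - l)    ≈⟨ x+[y-x]≈y l k ⟩
    k              ∎)
    where
    n : ℕ
    n = M ℕ.⊔ N

  partialSum-mono-≤ : ∀ {a b} → (∀ t → a t ≤ b t) → ∀ n → partialSum a n ≤ partialSum b n
  partialSum-mono-≤ a≤b zero    = ≤-reflexive ≈-refl
  partialSum-mono-≤ a≤b (suc n) =
    +-mono-≤ (partialSum-mono-≤ a≤b n) (*-monoʳ-≤-pos (0<γ^ n) (a≤b n))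

  partialSum-0 : ∀ n → partialSum (λ _ → 0#) n ≈ 0#
  partialSum-0 zero    = ≈-refl
  partialSum-0 (suc n) = ≈-trans (+-cong (partialSum-0 n) (zeroʳ (γ ^ n))) (+-identityˡ 0#)

  partialSum-+ : ∀ a b n → partialSum a n + partialSum b n ≈ partialSum (λ t → a t + b t) n
  partialSum-+ a b zero    = +-identityˡ 0#
  partialSum-+ a b (suc n) = begin-equality
    (partialSum a n + γ ^ n * a n) + (partialSum b n + γ ^ n * b n)
      ≈⟨ solve 5 (λ p q g x y → (p :+ g :* x) :+ (q :+ g :* y) := (p :+ q) :+ g :* (x :+ y))
           ≈-refl (partialSum a n) (partialSum b n) (γ ^ n) (a n) (b n) ⟩
    (partialSum a n + partialSum b n) + γ ^ n * (a n + b n)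
      ≈⟨ +-congʳ (partialSum-+ a b n) ⟩
    partialSum (λ t → a t + b t) n + γ ^ n * (a n + b n)  ∎

  discountedSum-⟶ : ∀ a (bd : Bounded a) → partialSum a ⟶ discountedSum a bd
  discountedSum-⟶ a bd = proj₂ (complete (partialSum a) (partialSum-cauchy a bd))

  discountedSum-nonneg : ∀ a (bd : Bounded a) → (∀ t → 0# ≤ a t) → 0# ≤ discountedSum a bd
  discountedSum-nonneg a bd 0≤a = ⟶-mono-≤ (⟶-const 0#) (discountedSum-⟶ a bd) λ n → begin
    0#                          ≈⟨ partialSum-0 n ⟨
    partialSum (λ _ → 0#) n     ≤⟨ partialSum-mono-≤ 0≤a n ⟩
    partialSum a n              ∎

  discountedSum-+-nonpos : ∀ a b d (bdᵃ : Bounded a) (bdᵇ : Bounded b) (bdᵈ : Bounded d) →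
    (∀ t → (a t + b t) + d t ≤ 0#) →
    (discountedSum a bdᵃ + discountedSum b bdᵇ) + discountedSum d bdᵈ ≤ 0#
  discountedSum-+-nonpos a b d bdᵃ bdᵇ bdᵈ nonpos =
    ⟶-mono-≤ (⟶-+ (⟶-+ (discountedSum-⟶ a bdᵃ) (discountedSum-⟶ b bdᵇ)) (discountedSum-⟶ d bdᵈ))
      (⟶-const 0#) λ n → begin
        (partialSum a n + partialSum b n) + partialSum d n    ≈⟨ +-congʳ (partialSum-+ a b n) ⟩
        partialSum (λ t → a t + b t) n + partialSum d n       ≈⟨ partialSum-+ _ d n ⟩
        partialSum (λ t → (a t + b t) + d t) n                ≤⟨ partialSum-mono-≤ nonpos n ⟩
        partialSum (λ _ → 0#) n                               ≈⟨ partialSum-0 n ⟩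
        0#                                                    ∎

-- Signs of the payoffs and the equilibrium argument.

module NoCapturingEquilibrium
  {c ℓ₁ ℓ₂} (ℝ : RealNumbers c ℓ₁ ℓ₂) (δ : DiscountFactor ℝ) (G : Graph)
  where

  open RealNumbers ℝ
  open OrderProperties ℝ
  open LimitProperties ℝ δ
  open Γ₃ G
  open Payoffs ℝ δ

  0≤1 : 0# ≤ 1#
  0≤1 = <⇒≤ 0<1

  0≤0 : 0# ≤ 0#
  0≤0 = ≤-reflexive ≈-refl

  q¹-nonneg : ∀ s → 0# ≤ q P₁ s
  q¹-nonneg s̄     = 0≤0
  q¹-nonneg ⟪ s ⟫ with does (S̃¹? s)
  ... | true  = 0≤1
  ... | false = 0≤0

  q²-nonneg : ∀ {s} → ¬ S̃¹ s → 0# ≤ q P₂ ⟪ s ⟫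
  q²-nonneg {s} s∉S̃¹ with S̃¹? s | does (S̃²? s)
  ... | yes s∈S̃¹ | _     = contradiction s∈S̃¹ s∉S̃¹
  ... | no _     | true  = 0≤1
  ... | no _     | false = 0≤0

  q³-nonneg : ∀ {s} → ¬ S̃² s → 0# ≤ q P₃ ⟪ s ⟫
  q³-nonneg {s} s∉S̃² with does (S̃¹? s) | S̃²? s
  ... | true  | _        = 0≤0
  ... | false | yes s∈S̃² = contradiction s∈S̃² s∉S̃²
  ... | false | no _     = 0≤0

  q-sum-nonpos : ∀ s → (q P₁ s + q P₂ s) + q P₃ s ≤ 0#
  q-sum-nonpos s = ≤-reflexive (q-sum≈0 s)
    where
    0+0+0≈0 : (0# + 0#) + 0# ≈ 0#
    0+0+0≈0 = ≈-trans (+-identityʳ _) (+-identityʳ 0#)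

    q-sum≈0 : ∀ s → (q P₁ s + q P₂ s) + q P₃ s ≈ 0#
    q-sum≈0 s̄ = 0+0+0≈0
    q-sum≈0 ⟪ s ⟫ with does (S̃¹? s) | does (S̃²? s)
    ... | true  | _     = ≈-trans (+-identityʳ _) (-‿inverseʳ 1#)
    ... | false | true  = ≈-trans (+-congʳ (+-identityˡ 1#)) (-‿inverseʳ 1#)
    ... | false | false = 0+0+0≈0

  Q-sum-nonpos : ∀ s₀ σ → (Q P₁ s₀ σ + Q P₂ s₀ σ) + Q P₃ s₀ σ ≤ 0#
  Q-sum-nonpos s₀ σ = discountedSum-+-nonpos _ _ _ (bd P₁) (bd P₂) (bd P₃)
    (λ t → q-sum-nonpos (play s₀ σ t))
    where
    bd = λ n t → q-bounded n (play s₀ σ t)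

  -- Each payoff is at most the sum of all three, since the other two are nonnegative.
  no-positive-payoff : ∀ {s₀ σ} → 0# ≤ Q P₁ s₀ σ → 0# ≤ Q P₂ s₀ σ → 0# ≤ Q P₃ s₀ σ →
    (Q P₁ s₀ σ ≤ 0#) × (Q P₂ s₀ σ ≤ 0#)
  no-positive-payoff {s₀} {σ} 0≤x 0≤y 0≤z =
      (begin
        x            ≈⟨ ≈-trans (+-identityʳ _) (+-identityʳ x) ⟨
        x + 0# + 0#  ≤⟨ +-mono-≤ (+-monoʳ-≤ x 0≤y) 0≤z ⟩
        x + y + z    ≤⟨ Q-sum-nonpos s₀ σ ⟩
        0#           ∎)
    , (begin
        y            ≈⟨ ≈-trans (+-identityʳ _) (+-identityˡ y) ⟨
        0# + y + 0#  ≤⟨ +-mono-≤ (+-monoˡ-≤ y 0≤x) 0≤z ⟩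
        x + y + z    ≤⟨ Q-sum-nonpos s₀ σ ⟩
        0#           ∎)
    where
    open ≤-Reasoning
    x y z : Carrier
    x = Q P₁ s₀ σ
    y = Q P₂ s₀ σ
    z = Q P₃ s₀ σ

  module _ (ev : Evasion G) where

    open Evasion ev using (start)

    private
      -- The superscript names the evader, the last argument its pursuer.
      module Evade² = Evade G ev P₁
      module Evade³ = Evade G ev P₂

    x¹ x² x³ : Graph.V G
    x¹ = fromℕ< (ℕ.>-nonZero⁻¹ (Graph.order G))
    x² = proj₁ (start x¹)
    x³ = proj₁ (start x²)

    s₀ : S
    s₀ = x¹ ∷ x² ∷ x³ ∷ [] , P₁

    -- `P₁` moves first, so the invariant starts in the form `safe`. It rules out the only captures
    -- that cost `P₂` anything.
    Q²-nonneg : ∀ σ → 0# ≤ Q P₂ s₀ (σ [ P₂ ↦ Evade².evade ])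
    Q²-nonneg σ = discountedSum-nonneg _ _
      (λ t → nonneg _ (Evade².Evading-play σ s₀ (Evade².safe (λ ()) (proj₂ (start x¹))) t))
      where
      nonneg : ∀ s → Evade².Evading s → 0# ≤ q P₂ s
      nonneg s̄     _ = 0≤0
      nonneg ⟪ s ⟫ e = q²-nonneg {s} (Evade².Evading⇒≢ e)

    -- As for `P₂`; a capture of `P₂` by `P₁` may end the play but costs `P₃` nothing.
    Q³-nonneg : ∀ σ → 0# ≤ Q P₃ s₀ (σ [ P₃ ↦ Evade³.evade ])
    Q³-nonneg σ = discountedSum-nonneg _ _
      (λ t → nonneg _ (Evade³.Evading-play σ s₀ (Evade³.safe (λ ()) (proj₂ (start x²))) t))
      where
      nonneg : ∀ s → Evade³.Evading s → 0# ≤ q P₃ s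
      nonneg s̄     _ = 0≤0
      nonneg ⟪ s ⟫ e = q³-nonneg {s} (Evade³.Evading⇒≢ e)

    -- At equilibrium `P₂` and `P₃` get at least what deviating to evasion secures, and the turn
    -- payoffs of `P₁` are never negative.
    no-capturing-equilibrium : ∀ σ → IsNashEquilibrium s₀ σ → ∀ k → K₃ s₀ σ k → ¬ (k ℕ.> 0)
    no-capturing-equilibrium σ nash = λ
      { .1 (P₁-captures 0<Q¹) _ → proj₁ nonpos 0<Q¹
      ; .2 (P₂-captures 0<Q²) _ → proj₂ nonpos 0<Q²
      }
      where
      nonpos : (Q P₁ s₀ σ ≤ 0#) × (Q P₂ s₀ σ ≤ 0#)
      nonpos = no-positive-payoff
        (discountedSum-nonneg _ _ (λ t → q¹-nonneg (play s₀ σ t)))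
        (≤-trans (Q²-nonneg σ) (nash P₂ Evade².evade))
        (≤-trans (Q³-nonneg σ) (nash P₃ Evade³.evade))

theorem5p5 :
    ∀ {c ℓ₁ ℓ₂} (ℝ : RealNumbers c ℓ₁ ℓ₂) (G : Graph) (γ : DiscountFactor ℝ) →
    (∀ (s₀ : Γ₃.S G) →
      ∃[ σ̂ ] Γ₃.Payoffs.IsNashEquilibrium G ℝ γ s₀ σ̂ ×
        (∃[ k ] Γ₃.Payoffs.K₃ G ℝ γ s₀ σ̂ k × k ℕ.> 0)) →
    IsCopNumber G 1
theorem5p5 ℝ G γ capturing-equilibrium = one-cop-wins , at-least-one
  where
  open CopsAndRobbers G using (CopsWin)
  open NoCapturingEquilibrium ℝ γ G

  no-evasion : ¬ Evasion G
  no-evasion ev =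
    let σ̂ , nash , k , K₃≡k , k>0 = capturing-equilibrium (s₀ ev)
    in no-capturing-equilibrium ev σ̂ nash k K₃≡k k>0

  -- Determinacy turns the refutation of evasion into an actual strategy for the cop.
  one-cop-wins : CopsWin 1
  one-cop-wins = fromInj₁ (⊥-elim ∘ no-evasion) (SingleCop.determined G)

  at-least-one : ∀ j → CopsWin j → 1 ℕ.≤ j
  at-least-one zero    wins = contradiction wins (¬CopsWin0 G)
  at-least-one (suc j) _    = s≤s ℕ.z≤n
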